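{- Let $G=(V,E)$ be a connected graph, let $T$ be a spanning tree of $G$ rooted at $s$ which is an $\mathcal L$-tree of some DFS on $G$, and let $\rho$ be an arbitrary vertex order of $V$ ending in $s$. Let $\sigma$ be the order output by Ordering$(G,T,s,\rho)$. Then $T$ is an $\mathcal L$-tree of LexDFS rooted in $s$ if and only if $\sigma$ is a LexDFS order of $G$.
   Context: Graphs are finite, simple, undirected; $n=|V|$, $N(v)$ is the neighborhood of $v$. A vertex order is a linear order $\sigma=(v_1,\dots,v_n)$ of $V$; $\sigma(i)=v_i$; $u\prec_\sigma v$ means $u$ appears before $v$; $\sigma^-$ is the reverse order. DFS: a search that starts at a vertex and repeatedly visits an unvisited neighbor of the most recently visited vertex that still has an unvisited neighbor; a DFS order is any resulting order. DFS$^+(\tau)$ on a graph $H$: the DFS of $H$ starting at the last vertex of $\tau$ that, whenever several vertices may be visited next, visits the one rightmost in $\tau$. LexDFS started at $s$: label $s$ with $(0)$, all others with the empty label; for $i=1,\dots,n$ pick an unnumbered vertex $v$ with lexicographically largest label, set $\sigma(i)=v$, and prepend $i$ to the label of each unnumbered neighbor of $v$; a LexDFS order is any possible output. $\mathcal L$-tree of a vertex order $(v_1,\dots,v_n)$ of a connected graph: the spanning tree rooted at $v_1$ with an edge from each $v_i$ ($i>1$) to its rightmost neighbor $v_j$ with $j<i$. A rooted spanning tree $T$ (root $s$) is an $\mathcal L$-tree of a search $\mathcal P$ on $G$ if some $\mathcal P$-order of $G$ starting at $s$ has $\mathcal L$-tree $T$ (same edges and same root). Partition refinement: refining an ordered partition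 $(Q_1,\dots,Q_k)$ of $V$ with $S'\subseteq V$ replaces each $Q_i$ by $(Q_i\cap S',\,Q_i\setminus S')$ whenever both are nonempty. Procedure Ordering$(G,T,s,\rho)$: let $\beta$ be the reverse of a BFS order of $T$ starting at $s$; set $\mathcal Q=(V)$; for $i=1,\dots,n$, with $v=\beta(i)$, refine $\mathcal Q$ with $\{w\in N(v): w\prec_\beta v\}$; then order the vertices inside each class of $\mathcal Q$ according to $\rho^-$ and move the class $\{s\}$ to the leftmost position; let $\tau$ be the reverse of the resulting order of all vertices; output $\sigma=$ DFS$^+(\tau)$ on $T$. -}

module Defs where

open import Data.Bool using (if_then_else_; _∧_)
import Data.Bool.Properties as Bool
open import Data.Fin using (Fin)
open import Data.Fin.Properties using (_≟_)
open import Data.Fin.Subset using (Subset; ⊤; ⁅_⁆; _∩_; _─_)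
open import Data.Fin.Subset.Properties using (nonempty?) renaming (_∈?_ to _∈ₛ?_)
open import Data.List using (List; []; _∷_; [_]; _++_; allFin; concatMap; filter; foldl; head; last; partition; reverse)
open import Data.List.Membership.Propositional using (_∈_; _∉_)
open import Data.List.Relation.Binary.Lex.Strict using (Lex-≤)
open import Data.List.Relation.Binary.Permutation.Propositional using (_↭_)
import Data.List.Relation.Binary.Sublist.DecPropositional as Sublist
open import Data.List.Relation.Unary.All using (All)
open import Data.List.Relation.Unary.Linked using (Linked)
open import Data.List.Relation.Unary.Unique.Propositional using (Unique)
open import Data.Maybe using (just)
open import Data.Nat using (ℕ; suc; _<_)
open import Data.Product using (∃-syntax; _×_; uncurry)
open import Data.Sum using (_⊎_)
open import Data.Vec using (tabulate)
open import Data.Vec.Properties using (≡-dec)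
open import Function.Bundles using (_⇔_)
open import Level using (0ℓ)
open import Relation.Binary using (Rel; Decidable; Symmetric)
open import Relation.Binary.Construct.Closure.ReflexiveTransitive using (Star)
open import Relation.Binary.PropositionalEquality using (_≡_)
open import Relation.Nullary using (¬_; Dec; does)
open import Relation.Nullary.Decidable using (_×-dec_)

record Graph (n : ℕ) : Set₁ where
  infix 4 _~_ _~?_
  field
    _~_      : Rel (Fin n) 0ℓ
    _~?_     : Decidable _~_
    ~-sym    : Symmetric _~_
    ~-irrefl : ∀ {v} → ¬ (v ~ v)

open Graph public using () renaming (_~_ to Adj; _~?_ to adj?)

Connected : ∀ {n} → Graph n → Set
Connected G = ∀ u v → Star (Adj G) u v

Acyclic : ∀ {n} → Graph n → Set
Acyclic G = ∀ u v w ws →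
  Unique (u ∷ v ∷ w ∷ ws) → ¬ Linked (Adj G) (u ∷ v ∷ w ∷ ws ++ [ u ])

record IsSpanningTree {n} (G T : Graph n) : Set where
  field
    subgraph  : ∀ {u v} → Adj T u v → Adj G u v
    connected : Connected T
    acyclic   : Acyclic T

IsVertexOrder : ∀ {n} → List (Fin n) → Set
IsVertexOrder σ = σ ↭ allFin _

-- u ≺[ σ ] v: the two-element list (u , v) is a sublist of σ, which for a
-- vertex order σ says that u occurs before v.
infix 4 _≺[_]_ _≺[_]?_

_≺[_]_ : ∀ {n} → Fin n → List (Fin n) → Fin n → Set
u ≺[ σ ] v = Sublist._⊆_ _≟_ (u ∷ v ∷ []) σ

_≺[_]?_ : ∀ {n} (u : Fin n) (σ : List (Fin n)) (v : Fin n) → Dec (u ≺[ σ ] v)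
u ≺[ σ ]? v = Sublist._⊆?_ _≟_ (u ∷ v ∷ []) σ

-- Search orders of a connected graph.  Next xs v says that v may be visited
-- immediately after the nonempty sequence xs of visited vertices, which is
-- listed from the first visited to the most recently visited.

IsSearchOrder : ∀ {n} → (List (Fin n) → Fin n → Set) → List (Fin n) → Set
IsSearchOrder Next σ =
  IsVertexOrder σ ×
  (∀ x xs v ys → σ ≡ x ∷ xs ++ v ∷ ys → Next (x ∷ xs) v)

module _ {n} (G : Graph n) where

  Exhausted : List (Fin n) → Fin n → Set
  Exhausted visited u = ∀ w → Adj G u w → w ∈ visited

  -- v is an unvisited neighbour of the most recently visited vertex u that
  -- still has an unvisited neighbour.
  DFSNext : List (Fin n) → Fin n → Set
  DFSNext visited v = v ∉ visited × (∃[ as ] ∃[ u ] ∃[ bs ]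
    (visited ≡ as ++ u ∷ bs × Adj G u v × All (Exhausted visited) bs))

  -- The same with the least recently visited vertex: the queue discipline.
  BFSNext : List (Fin n) → Fin n → Set
  BFSNext visited v = v ∉ visited × (∃[ as ] ∃[ u ] ∃[ bs ]
    (visited ≡ as ++ u ∷ bs × Adj G u v × All (Exhausted visited) as))

  IsDFSOrder : List (Fin n) → Set
  IsDFSOrder = IsSearchOrder DFSNext

  IsBFSOrder : List (Fin n) → Set
  IsBFSOrder = IsSearchOrder BFSNext

  IsDFS⁺Order : List (Fin n) → List (Fin n) → Set
  IsDFS⁺Order τ σ =
    head σ ≡ last τ ×
    IsSearchOrder (λ visited v → DFSNext visited v ×
      (∀ w → DFSNext visited w → w ≡ v ⊎ w ≺[ τ ] v)) σ

Label : Set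
Label = List ℕ

infix 4 _≤ₗₑₓ_

_≤ₗₑₓ_ : Rel Label 0ℓ
_≤ₗₑₓ_ = Lex-≤ _≡_ _<_

module _ {n} (G : Graph n) where

  -- relabel i us v ℓ: the label of v, initially ℓ, after the vertices us
  -- have received the consecutive numbers i, i+1, ...
  relabel : ℕ → List (Fin n) → Fin n → Label → Label
  relabel i []       v ℓ = ℓ
  relabel i (u ∷ us) v ℓ =
    relabel (suc i) us v (if does (adj? G u v) then i ∷ ℓ else ℓ)

  -- Meaningful only for v not in numbered: a numbered vertex would also be
  -- relabelled here, but its label is never consulted.
  label : Fin n → List (Fin n) → Fin n → Label
  label s numbered v =
    relabel 1 numbered v (if does (v ≟ s) then [ 0 ] else [])

  IsLexDFSOrderFrom : Fin n → List (Fin n) → Set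
  IsLexDFSOrderFrom s σ =
    IsVertexOrder σ ×
    (∀ xs v ys → σ ≡ xs ++ v ∷ ys →
      ∀ w → w ∉ xs → label s xs w ≤ₗₑₓ label s xs v)

  IsLexDFSOrder : List (Fin n) → Set
  IsLexDFSOrder σ = ∃[ s ] IsLexDFSOrderFrom s σ

IsLParent : ∀ {n} → Graph n → List (Fin n) → Fin n → Fin n → Set
IsLParent G σ v p =
  Adj G v p × p ≺[ σ ] v ×
  (∀ w → Adj G v w → w ≺[ σ ] v → w ≡ p ⊎ w ≺[ σ ] p)

record IsLTreeOfOrder {n} (G : Graph n) (σ : List (Fin n)) (T : Graph n) (s : Fin n) : Set where
  field
    root  : head σ ≡ just s
    edges : ∀ u v → Adj T u v ⇔ (IsLParent G σ u v ⊎ IsLParent G σ v u)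

-- A search is given by its orders: IsOrder H σ says that σ is an order of
-- that search on H.
IsLTreeOf : ∀ {n} → (Graph n → List (Fin n) → Set) → (G T : Graph n) → Fin n → Set
IsLTreeOf IsOrder G T s = ∃[ σ ] (IsOrder G σ × IsLTreeOfOrder G σ T s)

OrderedPartition : ℕ → Set
OrderedPartition n = List (Subset n)

refineClass : ∀ {n} → Subset n → Subset n → List (Subset n)
refineClass S Q =
  if does (nonempty? (Q ∩ S)) ∧ does (nonempty? (Q ─ S))
  then (Q ∩ S) ∷ (Q ─ S) ∷ []
  else [ Q ]

refine : ∀ {n} → OrderedPartition n → Subset n → OrderedPartition n
refine 𝒬 S = concatMap (refineClass S) 𝒬

moveLeftmost : ∀ {n} → Subset n → OrderedPartition n → OrderedPartition n
moveLeftmost Q 𝒬 = uncurry _++_ (partition (λ R → ≡-dec Bool._≟_ R Q) 𝒬)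

module _ {n} (G : Graph n) where

  leftNeighbours : List (Fin n) → Fin n → Subset n
  leftNeighbours β v = tabulate λ w → does (adj? G v w ×-dec w ≺[ β ]? v)

  refineAlong : List (Fin n) → OrderedPartition n
  refineAlong β = foldl (λ 𝒬 v → refine 𝒬 (leftNeighbours β v)) [ ⊤ ] β

  tieBreak : Fin n → (ρ β : List (Fin n)) → List (Fin n)
  tieBreak s ρ β = reverse
    (concatMap (λ Q → filter (_∈ₛ? Q) (reverse ρ))
               (moveLeftmost ⁅ s ⁆ (refineAlong β)))

-- A relation rather than a function, since the BFS order is not determined
-- by the input: σ is an output for some choice of it.
IsOrderingOutput : ∀ {n} → (G T : Graph n) → Fin n → (ρ σ : List (Fin n)) → Set
IsOrderingOutput G T s ρ σ = ∃[ bfs ]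
  (IsBFSOrder T bfs × head bfs ≡ just s ×
   IsDFS⁺Order T (tieBreak G s ρ (reverse bfs)) σ)

{-# OPTIONS --safe #-}

-- An ℒ-tree of a DFS is a spanning tree T in which adjacent vertices of G are
-- comparable.  Hence every order listing parents before children sees, among
-- the left neighbours of a vertex, only ancestors, and all such orders agree on
-- the ancestors of a vertex; in particular T is the ℒ-tree of σ.
--
-- When σ visits a child v of u, let c be the topmost unvisited ancestor of
-- another unvisited vertex w.  If the parent of c was visited before u, then u
-- itself makes the label of v larger than that of w.  Otherwise c is a child of
-- u, and a LexDFS order with ℒ-tree T shows, at the moment it visits c, that w
-- has no larger label than c.  Finally the partition refinement compares
-- siblings first by the deepest ancestor adjacent to only one of them, as the
-- labels do, so the label of c does not exceed that of v.
module Submission where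

open import Defs
open import Data.Bool using (true; if_then_else_)
import Data.Bool.Properties as Bool
open import Data.Fin using (Fin)
open import Data.Fin.Properties using (_≟_)
open import Data.Fin.Subset using (Subset; ⊤; ⁅_⁆; _∩_; _─_) renaming (_∈_ to _∈ₛ_; _∉_ to _∉ₛ_)
open import Data.Fin.Subset.Properties using (nonempty?; ∈⊤; x∈⁅x⁆; x∈⁅y⁆⇒x≡y; x∈p∩q⁺; x∈p∩q⁻; x∈p∧x∉q⇒x∈p─q; p─q⊆p; ⊆-antisym) renaming (_∈?_ to _∈ₛ?_)
open import Data.List using (List; []; _∷_; [_]; _++_; _ʳ++_; concatMap; filter; foldl; head; last; length; reverse)
open import Data.List.Membership.Propositional using (_∈_; _∉_; find)
open import Data.List.Membership.Propositional.Properties using (∈-∃++; ∈-++⁺ʳ; ∈-++⁻; ∈-allFin; ∈-concatMap⁻; ∈-filter⁺; ∈-filter⁻)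
import Data.List.Membership.DecPropositional as DecMembership
open import Data.List.Properties using (++-assoc; foldl-++; partition-defn; reverse-involutive; unfold-reverse)
open import Data.List.Relation.Binary.Lex.Strict using (base; halt; this; next; ≤-reflexive; ≤-transitive)
open import Data.List.Relation.Binary.Permutation.Propositional using (↭-sym; ↭⇒↭ₛ)
open import Data.List.Relation.Binary.Permutation.Propositional.Properties using (∈-resp-↭; ↭-reverse)
import Data.List.Relation.Binary.Permutation.Setoid.Properties as ↭ₛ
import Data.List.Relation.Binary.Pointwise as Pointwise
open import Data.List.Relation.Binary.Sublist.Propositional using (_⊆_; []; _∷_; _∷ʳ_; to∈; from∈; lookup)
open import Data.List.Relation.Binary.Sublist.Propositional.Properties using (++⁺; ++⁺ˡ; ++⁺ʳ; filter-⊆; reverse⁺)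
open import Data.List.Relation.Unary.All using (All; []; _∷_)
import Data.List.Relation.Unary.All as All
import Data.List.Relation.Unary.All.Properties as All
open import Data.List.Relation.Unary.AllPairs using ([]; _∷_)
open import Data.List.Relation.Unary.Any using (Any; here; there)
import Data.List.Relation.Unary.Any as Any
import Data.List.Relation.Unary.Any.Properties as Any
open import Data.List.Relation.Unary.Unique.Propositional using (Unique)
open import Data.List.Relation.Unary.Unique.Propositional.Properties using (allFin⁺; Unique[x∷xs]⇒x∉xs)
open import Data.Maybe using (just)
open import Data.Nat using (ℕ; suc; _<_)
import Data.Nat.Properties as ℕ
open import Data.Product using (∃-syntax; _×_; _,_; proj₁; proj₂; uncurry)
open import Data.Sum using (_⊎_; inj₁; inj₂)
import Data.Sum as Sum
open import Data.Unit using (tt)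
open import Data.Vec.Base using (_∷_; here; there)
open import Data.Vec.Properties using (≡-dec; lookup∘tabulate; []=⇒lookup; lookup⇒[]=)
open import Function.Bundles using (_⇔_; mk⇔; Equivalence)
open import Induction.WellFounded using (Acc; acc; WellFounded)
open import Relation.Binary.Construct.Closure.ReflexiveTransitive using (Star; ε; _◅_; _◅◅_)
open import Relation.Binary.PropositionalEquality using (_≡_; _≢_; refl; sym; trans; cong; subst; setoid; isEquivalence)
open import Relation.Nullary using (¬_; contradiction; yes; no; does; proof; Reflects)
open import Relation.Nullary.Decidable using (_×-dec_; ¬?; dec-true; decidable-stable)
open import Relation.Nullary.Reflects using (invert)

private variable
  n : ℕ
  a c p s u v w x y : Fin n
  π π′ σ xs ys : List (Fin n)
  Q S : Subset n
  𝒬 𝒬′ : OrderedPartition n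

-- Positions in vertex orders

order-unique : IsVertexOrder σ → Unique σ
order-unique π = ↭ₛ.Unique-resp-↭ (setoid _) (↭⇒↭ₛ (↭-sym π)) (allFin⁺ _)

∈-order : IsVertexOrder σ → ∀ v → v ∈ σ
∈-order π v = ∈-resp-↭ (↭-sym π) (∈-allFin v)

≺⇒∈ˡ : u ≺[ σ ] v → u ∈ σ
≺⇒∈ˡ (_ ∷ʳ p)    = there (≺⇒∈ˡ p)
≺⇒∈ˡ (refl ∷ _) = here refl

≺⇒∈ʳ : u ≺[ σ ] v → v ∈ σ
≺⇒∈ʳ (_ ∷ʳ p) = there (≺⇒∈ʳ p)
≺⇒∈ʳ (_ ∷ p)  = there (to∈ p)

++⁺-≺ : u ∈ xs → v ∈ ys → u ≺[ xs ++ ys ] v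
++⁺-≺ u∈xs v∈ys = ++⁺ (from∈ u∈xs) (from∈ v∈ys)

++⁻-≺ : ∀ xs → u ≺[ xs ++ ys ] v → (u ∈ xs × v ∈ xs ++ ys) ⊎ u ≺[ ys ] v
++⁻-≺ []       p          = inj₂ p
++⁻-≺ (x ∷ xs) (refl ∷ p) = inj₁ (here refl , there (to∈ p))
++⁻-≺ (x ∷ xs) (_ ∷ʳ p) with ++⁻-≺ xs p
... | inj₁ (u∈ , v∈) = inj₁ (there u∈ , there v∈)
... | inj₂ q         = inj₂ q

≺-asym : Unique σ → u ≺[ σ ] v → ¬ v ≺[ σ ] u
≺-asym (_ ∷ !σ)     (_ ∷ʳ p)    (_ ∷ʳ q)    = ≺-asym !σ p q
≺-asym !xσ@(_ ∷ _) (_ ∷ʳ p)    (refl ∷ q) = Unique[x∷xs]⇒x∉xs !xσ (≺⇒∈ʳ p)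
≺-asym !xσ@(_ ∷ _) (refl ∷ p) (_ ∷ʳ q)    = Unique[x∷xs]⇒x∉xs !xσ (≺⇒∈ʳ q)
≺-asym !xσ@(_ ∷ _) (refl ∷ p) (refl ∷ q) = Unique[x∷xs]⇒x∉xs !xσ (to∈ q)

≺-irrefl : Unique σ → ¬ v ≺[ σ ] v
≺-irrefl !σ p = ≺-asym !σ p p

≺-trans : Unique σ → u ≺[ σ ] v → v ≺[ σ ] w → u ≺[ σ ] w
≺-trans (_ ∷ !σ)     (_ ∷ʳ p)    (_ ∷ʳ q)    = _ ∷ʳ ≺-trans !σ p q
≺-trans !xσ@(_ ∷ _) (_ ∷ʳ p)    (refl ∷ q) = contradiction (≺⇒∈ʳ p) (Unique[x∷xs]⇒x∉xs !xσ)
≺-trans !xσ@(_ ∷ _) (refl ∷ p) (_ ∷ʳ q)    = refl ∷ from∈ (≺⇒∈ʳ q)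
≺-trans !xσ@(_ ∷ _) (refl ∷ p) (refl ∷ q) = contradiction (to∈ p) (Unique[x∷xs]⇒x∉xs !xσ)

≺-total : u ∈ σ → v ∈ σ → u ≡ v ⊎ u ≺[ σ ] v ⊎ v ≺[ σ ] u
≺-total (here refl) (here refl) = inj₁ refl
≺-total (here refl) (there v∈)  = inj₂ (inj₁ (refl ∷ from∈ v∈))
≺-total (there u∈)  (here refl) = inj₂ (inj₂ (refl ∷ from∈ u∈))
≺-total (there u∈)  (there v∈) with ≺-total u∈ v∈
... | inj₁ eq        = inj₁ eq
... | inj₂ (inj₁ p) = inj₂ (inj₁ (_ ∷ʳ p))
... | inj₂ (inj₂ p) = inj₂ (inj₂ (_ ∷ʳ p))

∈-prefix⇒≺ : u ∈ xs → u ≺[ xs ++ v ∷ ys ] v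
∈-prefix⇒≺ u∈xs = ++⁺-≺ u∈xs (here refl)

≺⇒∈-prefix : ∀ xs → Unique (xs ++ v ∷ ys) → u ≺[ xs ++ v ∷ ys ] v → u ∈ xs
≺⇒∈-prefix xs !σ p with ++⁻-≺ xs p
... | inj₁ (u∈xs , _) = u∈xs
... | inj₂ (_ ∷ʳ q)   = contradiction (++⁺ˡ xs (refl ∷ from∈ (≺⇒∈ˡ q))) (≺-asym !σ p)
... | inj₂ (refl ∷ _) = contradiction p (≺-irrefl !σ)

prefix-∉ : ∀ xs → Unique (xs ++ v ∷ ys) → v ∉ xs
prefix-∉ xs !σ v∈xs = ≺-irrefl !σ (∈-prefix⇒≺ v∈xs)

≺⇒split : u ≺[ σ ] v → ∃[ x ] ∃[ xs ] ∃[ ys ] (σ ≡ x ∷ xs ++ v ∷ ys × u ∈ x ∷ xs)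
≺⇒split (refl ∷ p) with xs , ys , refl ← ∈-∃++ (to∈ p) = _ , xs , ys , refl , here refl
≺⇒split (y ∷ʳ p) with x , xs , ys , refl , u∈ ← ≺⇒split p = y , x ∷ xs , ys , refl , there u∈

≺-prefix : ∀ xs → Unique (xs ++ ys) → u ≺[ xs ++ ys ] v → v ∈ xs → u ≺[ xs ] v
≺-prefix (x ∷ xs) !xσ p (here refl) = contradiction p λ where
  (_ ∷ʳ q)   → Unique[x∷xs]⇒x∉xs !xσ (≺⇒∈ʳ q)
  (refl ∷ q) → Unique[x∷xs]⇒x∉xs !xσ (to∈ q)
≺-prefix (x ∷ xs) !xσ     (refl ∷ p) (there v∈xs) = refl ∷ from∈ v∈xs
≺-prefix (x ∷ xs) (_ ∷ !σ) (_ ∷ʳ p)   (there v∈xs) = x ∷ʳ ≺-prefix xs !σ p v∈xs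

≺-reverse⁻ : u ≺[ reverse σ ] v → v ≺[ σ ] u
≺-reverse⁻ {σ = σ} p = subst (_ ⊆_) (reverse-involutive σ) (reverse⁺ p)

-- The list is scanned from the left, keeping the scanned prefix accessible; all predecessors of the
-- next entry lie in that prefix.
≺-wellFounded : {σ : List (Fin n)} → Unique σ → WellFounded (_≺[ σ ]_)
≺-wellFounded {n = n} {σ} !σ v = acc λ u≺v → accessible [] σ refl (λ ()) (≺⇒∈ˡ u≺v)
  where
  accessible : ∀ (xs ys : List (Fin n)) → σ ≡ xs ++ ys →
    (∀ {u} → u ∈ xs → Acc (_≺[ σ ]_) u) → ∀ {u} → u ∈ σ → Acc (_≺[ σ ]_) u
  accessible xs [] eq rec u∈σ with ∈-++⁻ xs (subst (_ ∈_) eq u∈σ)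
  ... | inj₁ u∈xs = rec u∈xs
  accessible xs (y ∷ ys) eq rec = accessible (xs ++ [ y ]) ys (trans eq (sym (++-assoc xs [ y ] ys))) rec′
    where
    rec′ : ∀ {u} → u ∈ xs ++ [ y ] → Acc (_≺[ σ ]_) u
    rec′ u∈ with ∈-++⁻ xs u∈
    ... | inj₁ u∈xs       = rec u∈xs
    ... | inj₂ (here refl) = acc λ {w} w≺y →
      rec (≺⇒∈-prefix xs (subst Unique eq !σ) (subst (w ≺[_] y) eq w≺y))

last-reverse : (xs : List (Fin n)) → last (reverse xs) ≡ head xs
last-reverse []       = refl
last-reverse (x ∷ xs) = trans (cong last (unfold-reverse x xs)) (last-snoc (reverse xs))
  where
  last-snoc : ∀ ys → last (ys ++ [ x ]) ≡ just x
  last-snoc []           = refl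
  last-snoc (_ ∷ [])     = refl
  last-snoc (_ ∷ y ∷ ys) = last-snoc (y ∷ ys)

head-≺ : IsVertexOrder σ → head σ ≡ just x → v ≢ x → x ≺[ σ ] v
head-≺ {σ = _ ∷ _} π refl v≢x with ∈-order π _
... | here eq   = contradiction eq v≢x
... | there v∈σ = refl ∷ from∈ v∈σ

head-minimal : IsVertexOrder σ → head σ ≡ just x → ¬ v ≺[ σ ] x
head-minimal {x = x} {v = v} π eq p with v ≟ x
... | yes refl = ≺-irrefl (order-unique π) p
... | no  v≢x = ≺-asym (order-unique π) p (head-≺ π eq v≢x)

reverse-unique : Unique σ → Unique (reverse σ)
reverse-unique {σ = σ} = ↭ₛ.Unique-resp-↭ (setoid _) (↭⇒↭ₛ (↭-sym (↭-reverse σ)))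

prefix-unique : ∀ xs → Unique (xs ++ ys) → Unique xs
prefix-unique []       _          = []
prefix-unique (x ∷ xs) (x∉ ∷ !σ) = All.++⁻ˡ xs x∉ ∷ prefix-unique xs !σ

++⁺ʳ-≺ : u ≺[ xs ] v → u ≺[ xs ++ ys ] v
++⁺ʳ-≺ {ys = ys} = ++⁺ʳ ys

-- Labels

≤ₗₑₓ-refl : ∀ {ℓ} → ℓ ≤ₗₑₓ ℓ
≤ₗₑₓ-refl = ≤-reflexive _≡_ _<_ (Pointwise.refl refl)

≤ₗₑₓ-trans : ∀ {k ℓ m} → k ≤ₗₑₓ ℓ → ℓ ≤ₗₑₓ m → k ≤ₗₑₓ m
≤ₗₑₓ-trans = ≤-transitive isEquivalence ((λ {refl p → p}) , λ {refl p → p}) ℕ.<-trans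

module _ {n : ℕ} (G : Graph n) where
  open Graph G

  -- The label of v once the vertices of rs, listed from the last numbered one,
  -- have received the numbers length rs, …, 1.
  revLabel : List (Fin n) → Fin n → Label
  revLabel []       v = []
  revLabel (u ∷ rs) v = if does (u ~? v) then suc (length rs) ∷ revLabel rs v else revLabel rs v

  -- Generalising over the numbered vertices `rs` lets `relabel` and `ʳ++` unfold in step, the next
  -- number being one more than the length of `rs`.
  relabel-revLabel : ∀ us rs v →
    relabel G (suc (length rs)) us v (revLabel rs v) ≡ revLabel (us ʳ++ rs) v
  relabel-revLabel []       rs v = refl
  relabel-revLabel (u ∷ us) rs v = relabel-revLabel us (u ∷ rs) v

  -- The initial 0 occurs in the label of `s` only; every other label starts empty, as `revLabel`
  -- assumes.
  label-revLabel : ∀ us → v ≢ s → label G s us v ≡ revLabel (reverse us) v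
  label-revLabel {v} {s} us v≢s with v ≟ s
  ... | yes eq = contradiction eq v≢s
  ... | no  _  = relabel-revLabel us [] v

  revLabel-bounded : ∀ rs v → All (_< suc (length rs)) (revLabel rs v)
  revLabel-bounded []       v = []
  revLabel-bounded (u ∷ rs) v with u ~? v
  ... | yes _ = ℕ.≤-refl ∷ All.map ℕ.m<n⇒m<1+n (revLabel-bounded rs v)
  ... | no  _ = All.map ℕ.m<n⇒m<1+n (revLabel-bounded rs v)

  -- Numbers are prepended to labels, so the last visited vertex adjacent to
  -- exactly one of w and v decides the comparison of their labels.
  Outweighed : List (Fin n) → Fin n → Fin n → Set
  Outweighed us w v = ∀ {x} → x ∈ us → x ~ w → ¬ x ~ v → ∃[ y ] (x ≺[ us ] y × y ~ v × ¬ y ~ w)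

  private
    -- `Outweighed` read on the reversed list, whose head carries the largest number.
    RevOutweighed : List (Fin n) → Fin n → Fin n → Set
    RevOutweighed rs w v = ∀ {x} → x ∈ rs → x ~ w → ¬ x ~ v → ∃[ y ] (y ≺[ rs ] x × y ~ v × ¬ y ~ w)

    bounded⇒≤ₗₑₓ : ∀ {k ℓ m} → All (_< k) ℓ → ℓ ≤ₗₑₓ k ∷ m
    bounded⇒≤ₗₑₓ []        = halt
    bounded⇒≤ₗₑₓ (i<k ∷ _) = this i<k

    bounded⇒≰ₗₑₓ : ∀ {k ℓ m} → All (_< k) m → ¬ k ∷ ℓ ≤ₗₑₓ m
    bounded⇒≰ₗₑₓ (i<k ∷ _) (this k<i)    = ℕ.<-asym i<k k<i
    bounded⇒≰ₗₑₓ (i<k ∷ _) (next refl _) = ℕ.<-irrefl refl i<k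

    -- If the head `u` is adjacent to `w` only, no entry precedes it to serve as witness; if to `v`
    -- only, its number exceeds the whole label of `w`. Otherwise `u` does not separate the two and
    -- is never a witness, so the hypothesis passes to the tail.
    outweighed⇒revLabel≤ : ∀ rs → Unique rs → RevOutweighed rs w v → revLabel rs w ≤ₗₑₓ revLabel rs v
    outweighed⇒revLabel≤ []       _   _   = base tt
    outweighed⇒revLabel≤ {w} {v} (u ∷ rs) !urs@(_ ∷ !rs) out with u ~? w | u ~? v
    ... | no _ | yes _ = bounded⇒≤ₗₑₓ (revLabel-bounded rs w)
    ... | yes u~w | no u≁v with out (here refl) u~w u≁v
    ...   | _ , (_ ∷ʳ p)   , _   , _ = contradiction (≺⇒∈ʳ p) (Unique[x∷xs]⇒x∉xs !urs)
    ...   | _ , (refl ∷ _) , u~v , _ = contradiction u~v u≁v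
    outweighed⇒revLabel≤ {w} {v} (u ∷ rs) !urs@(_ ∷ !rs) out
        | yes u~w | yes _ = next refl (outweighed⇒revLabel≤ rs !rs out′)
      where
      out′ : RevOutweighed rs w v
      out′ x∈ x~w x≁v with out (there x∈) x~w x≁v
      ... | _ , (_ ∷ʳ p)   , y~v , y≁w = _ , p , y~v , y≁w
      ... | _ , (refl ∷ _) , _   , u≁w = contradiction u~w u≁w
    outweighed⇒revLabel≤ {w} {v} (u ∷ rs) !urs@(_ ∷ !rs) out
        | no _ | no u≁v = outweighed⇒revLabel≤ rs !rs out′
      where
      out′ : RevOutweighed rs w v
      out′ x∈ x~w x≁v with out (there x∈) x~w x≁v
      ... | _ , (_ ∷ʳ p)   , y~v , y≁w = _ , p , y~v , y≁w
      ... | _ , (refl ∷ _) , u~v , _   = contradiction u~v u≁v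

    -- The first entry separating the two must favour `v`, since one favouring `w` would give `w` a
    -- number above the rest of the label of `v`. That entry is the witness.
    revLabel≤⇒outweighed : ∀ rs → revLabel rs w ≤ₗₑₓ revLabel rs v → RevOutweighed rs w v
    revLabel≤⇒outweighed {w} {v} (u ∷ rs) le x∈ x~w x≁v with u ~? w | u ~? v
    ... | yes _ | no _ = contradiction le (bounded⇒≰ₗₑₓ (revLabel-bounded rs v))
    revLabel≤⇒outweighed (u ∷ rs) le (here refl) x~w x≁v | _      | yes x~v = contradiction x~v x≁v
    revLabel≤⇒outweighed (u ∷ rs) le (here refl) x~w x≁v | no x≁w | _       = contradiction x~w x≁w
    revLabel≤⇒outweighed (u ∷ rs) le (there x∈) x~w x≁v | no u≁w | yes u~v = _ , refl ∷ from∈ x∈ , u~v , u≁w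
    revLabel≤⇒outweighed (u ∷ rs) (this i<i)  (there x∈) x~w x≁v | yes _ | yes _ =
      contradiction i<i (ℕ.<-irrefl refl)
    revLabel≤⇒outweighed (u ∷ rs) (next _ le) (there x∈) x~w x≁v | yes _ | yes _
      with y , p , y~v , y≁w ← revLabel≤⇒outweighed rs le x∈ x~w x≁v = y , u ∷ʳ p , y~v , y≁w
    revLabel≤⇒outweighed (u ∷ rs) le (there x∈) x~w x≁v | no _ | no _
      with y , p , y~v , y≁w ← revLabel≤⇒outweighed rs le x∈ x~w x≁v = y , u ∷ʳ p , y~v , y≁w

  outweighed⇒label≤ : ∀ us → Unique us → w ≢ s → v ≢ s →
    Outweighed us w v → label G s us w ≤ₗₑₓ label G s us v
  outweighed⇒label≤ {w} {s} {v} us !us w≢s v≢s out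
    rewrite label-revLabel us w≢s | label-revLabel us v≢s =
    outweighed⇒revLabel≤ (reverse us) (reverse-unique !us) λ x∈ x~w x≁v →
      let y , x≺y , y~v , y≁w = out (Any.reverse⁻ x∈) x~w x≁v in y , reverse⁺ x≺y , y~v , y≁w

  label≤⇒outweighed : ∀ us → w ≢ s → v ≢ s →
    label G s us w ≤ₗₑₓ label G s us v → Outweighed us w v
  label≤⇒outweighed {w} {s} {v} us w≢s v≢s le x∈ x~w x≁v
    rewrite label-revLabel us w≢s | label-revLabel us v≢s =
    let y , y≺x , y~v , y≁w = revLabel≤⇒outweighed (reverse us) le (Any.reverse⁺ x∈) x~w x≁v in
    y , ≺-reverse⁻ y≺x , y~v , y≁w

  -- The initial label `[ 0 ]` of the start vertex `s′` beats the empty label of all others, so `s′`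
  -- must be the head.
  lexDFS-root : IsLexDFSOrder G σ → head σ ≡ just s → IsLexDFSOrderFrom G s σ
  lexDFS-root {σ = s ∷ σ} (s′ , lex@(ord , maximal)) refl
    with s ≟ s′ | maximal [] s σ refl s′ (λ ())
  ... | yes refl | _ = lex
  ... | no _     | le with s′ ≟ s′
  lexDFS-root {σ = s ∷ σ} _ _ | no _ | () | yes _
  ... | no s′≢s′ = contradiction refl s′≢s′

  root-label-maximal : ∀ s w → label G s [] w ≤ₗₑₓ label G s [] s
  root-label-maximal s w with s ≟ s
  ... | no s≢s = contradiction refl s≢s
  ... | yes _ with w ≟ s
  ...   | yes _ = ≤ₗₑₓ-refl
  ...   | no _  = halt

-- Partition refinement

x∈p─q⇒x∉q : ∀ (p q : Subset n) → x ∈ₛ p ─ q → x ∉ₛ q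
x∈p─q⇒x∉q (_ ∷ p) (true  ∷ q) ()        here
x∈p─q⇒x∉q (_ ∷ p) (_     ∷ q) (there i) (there j) = x∈p─q⇒x∉q p q i j

-- The classes are not assumed disjoint: x ⊴ y and x ◁ y ask for some class of x
-- at or before, respectively strictly before, some class of y.
infix 4 _⊢_⊴_ _⊢_◁_

data _⊢_⊴_ {n} : OrderedPartition n → Fin n → Fin n → Set where
  here  : x ∈ₛ Q → Any (y ∈ₛ_) (Q ∷ 𝒬) → Q ∷ 𝒬 ⊢ x ⊴ y
  there : 𝒬 ⊢ x ⊴ y → Q ∷ 𝒬 ⊢ x ⊴ y

data _⊢_◁_ {n} : OrderedPartition n → Fin n → Fin n → Set where
  here  : x ∈ₛ Q → Any (y ∈ₛ_) 𝒬 → Q ∷ 𝒬 ⊢ x ◁ y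
  there : 𝒬 ⊢ x ◁ y → Q ∷ 𝒬 ⊢ x ◁ y

class⇒⊴ : Q ∈ 𝒬 → x ∈ₛ Q → y ∈ₛ Q → 𝒬 ⊢ x ⊴ y
class⇒⊴ (here refl) x∈Q y∈Q = here x∈Q (here y∈Q)
class⇒⊴ (there Q∈)  x∈Q y∈Q = there (class⇒⊴ Q∈ x∈Q y∈Q)

⊴-skip : All (x ∉ₛ_) 𝒬 → 𝒬 ++ 𝒬′ ⊢ x ⊴ y → 𝒬′ ⊢ x ⊴ y
⊴-skip []         p            = p
⊴-skip (x∉Q ∷ _) (here x∈Q _) = contradiction x∈Q x∉Q
⊴-skip (_ ∷ x∉)  (there p)    = ⊴-skip x∉ p

⊴-mono : 𝒬 ⊆ 𝒬′ → 𝒬 ⊢ x ⊴ y → 𝒬′ ⊢ x ⊴ y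
⊴-mono (_ ∷ʳ τ)     p            = there (⊴-mono τ p)
⊴-mono τ@(refl ∷ _) (here x∈ y∈) = here x∈ (lookup τ y∈)
⊴-mono (refl ∷ τ)   (there p)    = there (⊴-mono τ p)

-- `whole` keeps the one fact needed about an unsplit class: `S` contains all of it or none of it.
data RefinedClass {n} (S Q : Subset n) : List (Subset n) → Set where
  split : RefinedClass S Q ((Q ∩ S) ∷ (Q ─ S) ∷ [])
  whole : (∀ {x y} → x ∈ₛ Q → y ∈ₛ Q → y ∈ₛ S → x ∈ₛ S) → RefinedClass S Q [ Q ]

refinedClass : (S Q : Subset n) → RefinedClass S Q (refineClass S Q)
refinedClass S Q with nonempty? (Q ∩ S) | nonempty? (Q ─ S)
... | yes _ | yes _ = split
... | yes _ | no ∅ = whole λ {x} x∈Q _ _ →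
  decidable-stable (x ∈ₛ? S) λ x∉S → ∅ (x , x∈p∧x∉q⇒x∈p─q x∈Q x∉S)
... | no ∅  | _    = whole λ {_} {y} _ y∈Q y∈S → contradiction (y , x∈p∩q⁺ (y∈Q , y∈S)) ∅

refine-covers : ∀ (𝒬 : OrderedPartition n) S → Any (x ∈ₛ_) 𝒬 → Any (x ∈ₛ_) (refine 𝒬 S)
refine-covers {x = x} (Q ∷ 𝒬) S x∈ with refineClass S Q | refinedClass S Q
refine-covers (Q ∷ 𝒬) S (there x∈)  | _ | split   = there (there (refine-covers 𝒬 S x∈))
refine-covers (Q ∷ 𝒬) S (there x∈)  | _ | whole _ = there (refine-covers 𝒬 S x∈)
refine-covers (Q ∷ 𝒬) S (here x∈Q)  | _ | whole _ = here x∈Q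
refine-covers {x = x} (Q ∷ 𝒬) S (here x∈Q) | _ | split with x ∈ₛ? S
... | yes x∈S = here (x∈p∩q⁺ (x∈Q , x∈S))
... | no  x∉S = there (here (x∈p∧x∉q⇒x∈p─q x∈Q x∉S))

refine-covers⁻ : ∀ (𝒬 : OrderedPartition n) S → Any (x ∈ₛ_) (refine 𝒬 S) → Any (x ∈ₛ_) 𝒬
refine-covers⁻ (Q ∷ 𝒬) S x∈ with refineClass S Q | refinedClass S Q
refine-covers⁻ (Q ∷ 𝒬) S (here x∈)          | _ | split = here (proj₁ (x∈p∩q⁻ Q S x∈))
refine-covers⁻ (Q ∷ 𝒬) S (there (here x∈))  | _ | split = here (p─q⊆p Q S x∈)
refine-covers⁻ (Q ∷ 𝒬) S (there (there x∈)) | _ | split = there (refine-covers⁻ 𝒬 S x∈)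
refine-covers⁻ (Q ∷ 𝒬) S (here x∈)          | _ | whole _ = here x∈
refine-covers⁻ (Q ∷ 𝒬) S (there x∈)         | _ | whole _ = there (refine-covers⁻ 𝒬 S x∈)

refine-⊴⁻ : ∀ (𝒬 : OrderedPartition n) S → refine 𝒬 S ⊢ x ⊴ y → 𝒬 ⊢ x ⊴ y
refine-⊴⁻ (Q ∷ 𝒬) S p with refineClass S Q | refinedClass S Q
refine-⊴⁻ (Q ∷ 𝒬) S (here x∈ (here y∈)) | _ | split =
  here (proj₁ (x∈p∩q⁻ Q S x∈)) (here (proj₁ (x∈p∩q⁻ Q S y∈)))
refine-⊴⁻ (Q ∷ 𝒬) S (here x∈ (there (here y∈))) | _ | split = here (proj₁ (x∈p∩q⁻ Q S x∈)) (here (p─q⊆p Q S y∈))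
refine-⊴⁻ (Q ∷ 𝒬) S (here x∈ (there (there y∈))) | _ | split =
  here (proj₁ (x∈p∩q⁻ Q S x∈)) (there (refine-covers⁻ 𝒬 S y∈))
refine-⊴⁻ (Q ∷ 𝒬) S (there (here x∈ (here y∈))) | _ | split = here (p─q⊆p Q S x∈) (here (p─q⊆p Q S y∈))
refine-⊴⁻ (Q ∷ 𝒬) S (there (here x∈ (there y∈))) | _ | split =
  here (p─q⊆p Q S x∈) (there (refine-covers⁻ 𝒬 S y∈))
refine-⊴⁻ (Q ∷ 𝒬) S (there (there p)) | _ | split = there (refine-⊴⁻ 𝒬 S p)
refine-⊴⁻ (Q ∷ 𝒬) S (here x∈ (here y∈)) | _ | whole _ = here x∈ (here y∈)
refine-⊴⁻ (Q ∷ 𝒬) S (here x∈ (there y∈)) | _ | whole _ = here x∈ (there (refine-covers⁻ 𝒬 S y∈))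
refine-⊴⁻ (Q ∷ 𝒬) S (there p) | _ | whole _ = there (refine-⊴⁻ 𝒬 S p)

-- Refinement puts the members of `S` first within each class, so an `x` outside `S` gets ahead of a
-- `y` in `S` only by way of an earlier class.
refine-⊴⇒◁ : ∀ (𝒬 : OrderedPartition n) S → refine 𝒬 S ⊢ x ⊴ y → y ∈ₛ S → x ∉ₛ S → 𝒬 ⊢ x ◁ y
refine-⊴⇒◁ (Q ∷ 𝒬) S p y∈S x∉S with refineClass S Q | refinedClass S Q
refine-⊴⇒◁ (Q ∷ 𝒬) S (here x∈ _) y∈S x∉S | _ | split =
  contradiction (proj₂ (x∈p∩q⁻ Q S x∈)) x∉S
refine-⊴⇒◁ (Q ∷ 𝒬) S (there (here _ (here y∈))) y∈S x∉S | _ | split =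
  contradiction y∈S (x∈p─q⇒x∉q Q S y∈)
refine-⊴⇒◁ (Q ∷ 𝒬) S (there (here x∈ (there y∈))) y∈S x∉S | _ | split =
  here (p─q⊆p Q S x∈) (refine-covers⁻ 𝒬 S y∈)
refine-⊴⇒◁ (Q ∷ 𝒬) S (there (there p)) y∈S x∉S | _ | split = there (refine-⊴⇒◁ 𝒬 S p y∈S x∉S)
refine-⊴⇒◁ (Q ∷ 𝒬) S (here x∈ (here y∈)) y∈S x∉S | _ | whole closed = contradiction (closed x∈ y∈ y∈S) x∉S
refine-⊴⇒◁ (Q ∷ 𝒬) S (here x∈ (there y∈)) y∈S x∉S | _ | whole _ = here x∈ (refine-covers⁻ 𝒬 S y∈)
refine-⊴⇒◁ (Q ∷ 𝒬) S (there p) y∈S x∉S | _ | whole _ = there (refine-⊴⇒◁ 𝒬 S p y∈S x∉S)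

refine-◁⁻ : ∀ (𝒬 : OrderedPartition n) S → refine 𝒬 S ⊢ x ◁ y → 𝒬 ⊢ x ◁ y ⊎ (x ∈ₛ S × y ∉ₛ S)
refine-◁⁻ (Q ∷ 𝒬) S p with refineClass S Q | refinedClass S Q
refine-◁⁻ (Q ∷ 𝒬) S (here x∈ (here y∈)) | _ | split = inj₂ (proj₂ (x∈p∩q⁻ Q S x∈) , x∈p─q⇒x∉q Q S y∈)
refine-◁⁻ (Q ∷ 𝒬) S (here x∈ (there y∈)) | _ | split =
  inj₁ (here (proj₁ (x∈p∩q⁻ Q S x∈)) (refine-covers⁻ 𝒬 S y∈))
refine-◁⁻ (Q ∷ 𝒬) S (there (here x∈ y∈)) | _ | split = inj₁ (here (p─q⊆p Q S x∈) (refine-covers⁻ 𝒬 S y∈))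
refine-◁⁻ (Q ∷ 𝒬) S (there (there p)) | _ | split = Sum.map₁ there (refine-◁⁻ 𝒬 S p)
refine-◁⁻ (Q ∷ 𝒬) S (here x∈ y∈) | _ | whole _ = inj₁ (here x∈ (refine-covers⁻ 𝒬 S y∈))
refine-◁⁻ (Q ∷ 𝒬) S (there p) | _ | whole _ = Sum.map₁ there (refine-◁⁻ 𝒬 S p)

module _ {n} (N : Fin n → Subset n) where

  refineBy : OrderedPartition n → List (Fin n) → OrderedPartition n
  refineBy = foldl (λ 𝒬 v → refine 𝒬 (N v))

  refineBy-covers : ∀ us → Any (x ∈ₛ_) 𝒬 → Any (x ∈ₛ_) (refineBy 𝒬 us)
  refineBy-covers []       x∈ = x∈
  refineBy-covers (u ∷ us) x∈ = refineBy-covers us (refine-covers _ (N u) x∈)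

  refineBy-⊴⁻ : ∀ us → refineBy 𝒬 us ⊢ x ⊴ y → 𝒬 ⊢ x ⊴ y
  refineBy-⊴⁻ []       p = p
  refineBy-⊴⁻ (u ∷ us) p = refine-⊴⁻ _ (N u) (refineBy-⊴⁻ us p)

  refineBy-◁⁻ : ∀ us → refineBy 𝒬 us ⊢ x ◁ y → 𝒬 ⊢ x ◁ y ⊎ ∃[ z ] (z ∈ us × x ∈ₛ N z × y ∉ₛ N z)
  refineBy-◁⁻ []       p = inj₁ p
  refineBy-◁⁻ (u ∷ us) p with refineBy-◁⁻ us p
  ... | inj₂ (z , z∈us , xy) = inj₂ (z , there z∈us , xy)
  ... | inj₁ q = Sum.map₂ (λ xy → u , here refl , xy) (refine-◁⁻ _ (N u) q)

  -- Later refinements never reverse an order, so `x` was strictly ahead of `y` when `z`, which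
  -- favours `y`, was processed. The initial single class has no strict precedence, hence some
  -- earlier `z′` separated them in favour of `x`.
  refineBy-⊴ : ∀ us {z vs} → refineBy [ ⊤ ] (us ++ z ∷ vs) ⊢ x ⊴ y →
    y ∈ₛ N z → x ∉ₛ N z → ∃[ z′ ] (z′ ∈ us × x ∈ₛ N z′ × y ∉ₛ N z′)
  refineBy-⊴ us {z} {vs} p y∈ x∉
    rewrite foldl-++ (λ 𝒬 v → refine 𝒬 (N v)) [ ⊤ ] us (z ∷ vs)
    with refineBy-◁⁻ us (refine-⊴⇒◁ _ (N z) (refineBy-⊴⁻ vs p) y∈ x∉)
  ... | inj₂ earlier      = earlier
  ... | inj₁ (here _ ())
  ... | inj₁ (there ())

moveLeftmost-defn : ∀ (Q : Subset n) 𝒬 → let =Q? = λ R → ≡-dec Bool._≟_ R Q in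
  moveLeftmost Q 𝒬 ≡ filter =Q? 𝒬 ++ filter (λ R → ¬? (=Q? R)) 𝒬
moveLeftmost-defn Q 𝒬 = cong (uncurry _++_) (partition-defn (λ R → ≡-dec Bool._≟_ R Q) 𝒬)

-- The copies of `Q` moved to the front do not contain `x`, and the remaining classes form a sublist
-- of `𝒬`.
moveLeftmost-⊴⁻ : ∀ (Q : Subset n) 𝒬 → x ∉ₛ Q → moveLeftmost Q 𝒬 ⊢ x ⊴ y → 𝒬 ⊢ x ⊴ y
moveLeftmost-⊴⁻ {x = x} Q 𝒬 x∉Q p rewrite moveLeftmost-defn Q 𝒬 =
  ⊴-mono (filter-⊆ _ 𝒬) (⊴-skip (All.tabulate λ R∈ → x∉ (proj₂ (∈-filter⁻ _ {xs = 𝒬} R∈))) p)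
  where
  x∉ : ∀ {R} → R ≡ Q → x ∉ₛ R
  x∉ refl = x∉Q

listClasses : List (Fin n) → OrderedPartition n → List (Fin n)
listClasses ρ = concatMap (λ Q → filter (_∈ₛ? Q) ρ)

listClasses-≺⁻ : ∀ ρ (𝒬 : OrderedPartition n) → x ≺[ listClasses ρ 𝒬 ] y → 𝒬 ⊢ x ⊴ y
listClasses-≺⁻ ρ (Q ∷ 𝒬) p with ++⁻-≺ (filter (_∈ₛ? Q) ρ) p
... | inj₂ q          = there (listClasses-≺⁻ ρ 𝒬 q)
... | inj₁ (x∈ , y∈) = here (proj₂ (∈-filter⁻ (_∈ₛ? Q) {xs = ρ} x∈))
  (Any.map (λ {R} y∈′ → proj₂ (∈-filter⁻ (_∈ₛ? R) {xs = ρ} y∈′))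
    (∈-concatMap⁻ (λ R → filter (_∈ₛ? R) ρ) {xs = Q ∷ 𝒬} y∈))

head-nonempty : ∀ {xs ys : List (Fin n)} → x ∈ xs → (∀ {y} → y ∈ xs → y ≡ x) → head (xs ++ ys) ≡ just x
head-nonempty {xs = _ ∷ _} _ eq = cong just (eq (here refl))

head-listClasses-moveLeftmost : ∀ {ρ : List (Fin n)} → x ∈ ρ → ⁅ x ⁆ ∈ 𝒬 →
  head (listClasses ρ (moveLeftmost ⁅ x ⁆ 𝒬)) ≡ just x
head-listClasses-moveLeftmost {x = x} {𝒬 = 𝒬} {ρ} x∈ρ x∈𝒬 rewrite moveLeftmost-defn ⁅ x ⁆ 𝒬
  -- The filtered list is abstracted together with its membership facts, so that it can be matched
  -- as nonempty.
  with filter (λ R → ≡-dec Bool._≟_ R ⁅ x ⁆) 𝒬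
     | ∈-filter⁺ (λ R → ≡-dec Bool._≟_ R ⁅ x ⁆) x∈𝒬 refl
     | (λ {R} → ∈-filter⁻ (λ R → ≡-dec Bool._≟_ R ⁅ x ⁆) {v = R} {xs = 𝒬})
... | R ∷ _ | _ | ∈filter⁻ with refl ← proj₂ (∈filter⁻ (here refl)) =
  head-nonempty (∈-filter⁺ (_∈ₛ? ⁅ x ⁆) x∈ρ (x∈⁅x⁆ x))
    (λ y∈ → x∈⁅y⁆⇒x≡y x (proj₂ (∈-filter⁻ (_∈ₛ? ⁅ x ⁆) {xs = ρ} y∈)))

module _ {n} (G : Graph n) (β : List (Fin n)) where

  ∈-leftNeighbours⁺ : Adj G v w → w ≺[ β ] v → w ∈ₛ leftNeighbours G β v
  ∈-leftNeighbours⁺ {v} {w} v~w w≺v = lookup⇒[]= w _ (trans (lookup∘tabulate _ w)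
    (dec-true (adj? G v w ×-dec w ≺[ β ]? v) (v~w , w≺v)))

  ∈-leftNeighbours⁻ : w ∈ₛ leftNeighbours G β v → Adj G v w × w ≺[ β ] v
  ∈-leftNeighbours⁻ {w} {v} w∈ = invert (subst (Reflects _)
    (trans (sym (lookup∘tabulate _ w)) ([]=⇒lookup w∈)) (proof (adj? G v w ×-dec w ≺[ β ]? v)))

-- Search trees

LParent-unique : ∀ {n} {G : Graph n} {σ v p q} → Unique σ → IsLParent G σ v p → IsLParent G σ v q → p ≡ q
LParent-unique !σ (v~p , p≺v , p-max) (v~q , q≺v , q-max) with p-max _ v~q q≺v
... | inj₁ q≡p = sym q≡p
... | inj₂ q≺p with q-max _ v~p p≺v
...   | inj₁ p≡q = p≡q
...   | inj₂ p≺q = contradiction p≺q (≺-asym !σ q≺p)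

-- The rooted spanning trees of G for which every edge of G joins a vertex to
-- one of its ancestors; v ↑ p says that p is the parent of v.
record TrémauxTree {n} (G T : Graph n) (s : Fin n) : Set₁ where
  field
    _↑_        : Fin n → Fin n → Set
    ↑-unique   : ∀ {v p q} → v ↑ p → v ↑ q → p ≡ q
    ↑-asym     : ∀ {u v} → u ↑ v → ¬ v ↑ u
    root-top   : ∀ {p} → ¬ s ↑ p
    ↑⇒Adj      : ∀ {v p} → v ↑ p → Adj G v p
    Adj⇔↑      : ∀ {u v} → Adj T u v ⇔ (u ↑ v ⊎ v ↑ u)
    to-root    : ∀ v → Star _↑_ v s
    comparable : ∀ {u v} → Adj G u v → Star _↑_ u v ⊎ Star _↑_ v u

module _ {n} {G T : Graph n} {s : Fin n} {δ : List (Fin n)}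
  (dfs : IsDFSOrder G δ) (ltree : IsLTreeOfOrder G δ T s) where

  private
    module T = IsLTreeOfOrder ltree
    !δ = order-unique (proj₁ dfs)

    Parent : Fin n → Fin n → Set
    Parent = IsLParent G δ

  -- The last visited vertex with an unvisited neighbour v is the rightmost
  -- left neighbour of v, and every visited u with an unvisited neighbour is
  -- that vertex or lies to its left.
  dfs-parent : ∀ {x v} → x ≺[ δ ] v → ∃[ p ] (Parent v p ×
    (∀ {u y} → Adj G u y → u ≺[ δ ] v → ¬ y ≺[ δ ] v → u ≡ p ⊎ u ≺[ δ ] p))
  dfs-parent {v = v} x≺v with z , zs , ys , refl , _ ← ≺⇒split x≺v
    with v∉ , as , p , bs , eq , p~v , exhausted ← proj₂ dfs z zs v ys refl =
    p , (Graph.~-sym G p~v , ∈-prefix⇒≺ p∈ ,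
         λ w v~w w≺v → rightmost (Graph.~-sym G v~w) w≺v (≺-irrefl !δ)) , rightmost
    where
    p∈ : p ∈ z ∷ zs
    p∈ rewrite eq = ∈-++⁺ʳ as (here refl)

    rightmost : ∀ {u y} → Adj G u y → u ≺[ δ ] v → ¬ y ≺[ δ ] v → u ≡ p ⊎ u ≺[ δ ] p
    rightmost {u} {y} u~y u≺v y⊀v with ∈-++⁻ as (subst (u ∈_) eq (≺⇒∈-prefix (z ∷ zs) !δ u≺v))
    ... | inj₂ (here u≡p)    = inj₁ u≡p
    ... | inj₂ (there u∈bs) = contradiction (∈-prefix⇒≺ (All.lookup exhausted u∈bs y u~y)) y⊀v
    ... | inj₁ u∈as          = inj₂ (subst (λ us → u ≺[ us ++ v ∷ ys ] p) (sym eq)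
      (++⁺ʳ-≺ (∈-prefix⇒≺ u∈as)))

  -- By `dfs-parent`, `x` is the parent of `z` or precedes it. In the second case `y` is not before
  -- that parent either, so the climb continues there. For an edge, `y` and `z` both start as its
  -- later end; only `z` moves.
  dfs-ancestor : ∀ {x y z} → Adj G x y → x ≺[ δ ] z → ¬ y ≺[ δ ] z → Acc (_≺[ δ ]_) z → Star Parent z x
  dfs-ancestor x~y x≺z y⊀z (acc rec)
    with p , par@(_ , p≺z , _) , max ← dfs-parent x≺z with max x~y x≺z y⊀z
  ... | inj₁ refl = par ◅ ε
  ... | inj₂ x≺p = par ◅ dfs-ancestor x~y x≺p (λ y≺p → y⊀z (≺-trans !δ y≺p p≺z)) (rec p≺z)

  private
    root-path : ∀ {v} → Acc (_≺[ δ ]_) v → Star Parent v s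
    root-path {v} (acc rec) with v ≟ s
    ... | yes refl = ε
    ... | no  v≢s with p , par@(_ , p≺v , _) , _ ← dfs-parent (head-≺ (proj₁ dfs) T.root v≢s) =
      par ◅ root-path (rec p≺v)

  dfsTrémauxTree : TrémauxTree G T s
  dfsTrémauxTree = record
    { _↑_        = Parent
    ; ↑-unique   = LParent-unique {G = G} !δ
    ; ↑-asym     = λ (_ , p , _) (_ , q , _) → ≺-asym !δ p q
    ; root-top   = λ (_ , p≺s , _) → head-minimal (proj₁ dfs) T.root p≺s
    ; ↑⇒Adj      = proj₁
    ; Adj⇔↑      = T.edges _ _
    ; to-root    = λ v → root-path (≺-wellFounded !δ v)
    ; comparable = comparable
    }
    where
    comparable : ∀ {u v} → Adj G u v → Star Parent u v ⊎ Star Parent v u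
    comparable {u} {v} u~v with ≺-total (∈-order (proj₁ dfs) u) (∈-order (proj₁ dfs) v)
    ... | inj₁ refl         = inj₁ ε
    ... | inj₂ (inj₁ u≺v) = inj₂ (dfs-ancestor u~v u≺v (≺-irrefl !δ) (≺-wellFounded !δ v))
    ... | inj₂ (inj₂ v≺u) = inj₁ (dfs-ancestor (Graph.~-sym G u~v) v≺u (≺-irrefl !δ) (≺-wellFounded !δ u))

-- Orders that list parents before children

module _ {n} {G T : Graph n} {s : Fin n} (tree : TrémauxTree G T s) where
  open TrémauxTree tree

  _↟_ : Fin n → Fin n → Set
  _↟_ = Star _↑_

  -- The property shared by the BFS order, the output `σ` and every vertex order with ℒ-tree `T`.
  ParentsFirst : List (Fin n) → Set
  ParentsFirst π = ∀ {v p} → v ↑ p → p ≺[ π ] v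

  ↟-chain : u ↟ x → u ↟ y → x ↟ y ⊎ y ↟ x
  ↟-chain ε           u↟y         = inj₁ u↟y
  ↟-chain u↟x@(_ ◅ _) ε           = inj₂ u↟x
  ↟-chain (u↑p ◅ p↟x) (u↑q ◅ q↟y) with refl ← ↑-unique u↑p u↑q = ↟-chain p↟x q↟y

  ↟⇒≺ : Unique π → ParentsFirst π → v ↟ a → a ≡ v ⊎ a ≺[ π ] v
  ↟⇒≺ !π first ε = inj₁ refl
  ↟⇒≺ !π first (v↑p ◅ p↟a) with ↟⇒≺ !π first p↟a
  ... | inj₁ refl = inj₂ (first v↑p)
  ... | inj₂ a≺p  = inj₂ (≺-trans !π a≺p (first v↑p))

  -- The ancestors of `u` form a chain, which both orders list from the root downwards.
  ancestors-≺ : Unique π → ParentsFirst π → Unique π′ → ParentsFirst π′ →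
    u ↟ x → u ↟ y → x ≺[ π ] y → x ≺[ π′ ] y
  ancestors-≺ !π first !π′ first′ u↟x u↟y x≺y with ↟-chain u↟x u↟y
  ... | inj₁ x↟y with ↟⇒≺ !π first x↟y
  ...   | inj₁ refl = contradiction x≺y (≺-irrefl !π)
  ...   | inj₂ y≺x  = contradiction y≺x (≺-asym !π x≺y)
  ancestors-≺ !π first !π′ first′ u↟x u↟y x≺y | inj₂ y↟x with ↟⇒≺ !π′ first′ y↟x
  ...   | inj₁ refl = contradiction x≺y (≺-irrefl !π)
  ...   | inj₂ x≺′y  = x≺′y

  left-neighbour⇒ancestor : Unique π → ParentsFirst π → Adj G x w → x ≺[ π ] w → w ↟ x
  left-neighbour⇒ancestor !π first x~w x≺w with comparable x~w
  ... | inj₂ w↟x = w↟x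
  ... | inj₁ x↟w with ↟⇒≺ !π first x↟w
  ...   | inj₁ refl = contradiction x≺w (≺-irrefl !π)
  ...   | inj₂ w≺x  = contradiction x≺w (≺-asym !π w≺x)

  parent : v ≢ s → ∃[ p ] v ↑ p
  parent {v} v≢s with to-root v
  ... | ε       = contradiction refl v≢s
  ... | v↑p ◅ _ = _ , v↑p

  -- If the earlier T-neighbour u of v were a child of v, then v would already
  -- precede u by induction.
  connected-order⇒parentsFirst : IsVertexOrder π → head π ≡ just s →
    (∀ {v} → v ≢ s → ∃[ u ] (u ≺[ π ] v × Adj T u v)) → ParentsFirst π
  connected-order⇒parentsFirst {π} ord root attached {v} = go (≺-wellFounded !π v)
    where
    !π = order-unique ord

    go : ∀ {v p} → Acc (_≺[ π ]_) v → v ↑ p → p ≺[ π ] v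
    go {v} (acc rec) v↑p with v ≟ s
    ... | yes refl = contradiction v↑p root-top
    ... | no v≢s with u , u≺v , u~v ← attached v≢s with Equivalence.to Adj⇔↑ u~v
    ...   | inj₂ v↑u with refl ← ↑-unique v↑u v↑p = u≺v
    ...   | inj₁ u↑v = contradiction (go (rec u≺v) u↑v) (≺-asym !π u≺v)

  search-parentsFirst : IsVertexOrder π → head π ≡ just s →
    (∀ x xs v ys → π ≡ x ∷ xs ++ v ∷ ys → ∃[ u ] (u ∈ x ∷ xs × Adj T u v)) → ParentsFirst π
  search-parentsFirst ord root attached =
    connected-order⇒parentsFirst ord root λ v≢s →
      let x , xs , ys , eq , _ = ≺⇒split (head-≺ ord root v≢s)
          u , u∈ , u~v = attached x xs _ ys eq
      in u , subst (λ π → u ≺[ π ] _) (sym eq) (∈-prefix⇒≺ u∈) , u~v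

  -- Edges of `T` are undirected, so `v` might instead be the ℒ-parent of `p`. The root has no
  -- ℒ-parent; for any other `p`, induction along its path to the root makes its tree parent its
  -- ℒ-parent, so `v` would be that tree parent, against `v ↑ p`.
  ltree-parent : IsVertexOrder π → IsLTreeOfOrder G π T s → v ↑ p → IsLParent G π v p
  ltree-parent {π} ord ltree v↑p = go v↑p (to-root _)
    where
    open IsLTreeOfOrder ltree using (root; edges)

    go : v ↑ p → p ↟ s → IsLParent G π v p
    go v↑p p↟s with Equivalence.to (edges _ _) (Equivalence.from Adj⇔↑ (inj₁ v↑p))
    ... | inj₁ par = par
    go v↑p ε           | inj₂ (_ , v≺s , _) = contradiction v≺s (head-minimal ord root)
    go v↑p (p↑q ◅ q↟s) | inj₂ par
      with refl ← LParent-unique {G = G} (order-unique ord) par (go p↑q q↟s) =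
      contradiction p↑q (↑-asym v↑p)

  -- All left neighbours of `v` are proper ancestors, and the parent is the last of these in the
  -- order.
  parentsFirst⇒LParent : Unique π → ParentsFirst π → v ↑ p → IsLParent G π v p
  parentsFirst⇒LParent {v = v} {p = p} !π first v↑p = ↑⇒Adj v↑p , first v↑p , rightmost
    where
    rightmost : ∀ w → Adj G v w → w ≺[ _ ] v → w ≡ p ⊎ w ≺[ _ ] p
    rightmost w v~w w≺v with left-neighbour⇒ancestor !π first (Graph.~-sym G v~w) w≺v
    ... | ε = contradiction w≺v (≺-irrefl !π)
    ... | v↑q ◅ q↟w with refl ← ↑-unique v↑p v↑q = ↟⇒≺ !π first q↟w

  -- This yields the easy implication: `T` is the ℒ-tree of `σ` whatever the order among siblings.
  parentsFirst⇒ltree : IsVertexOrder π → head π ≡ just s → ParentsFirst π → IsLTreeOfOrder G π T s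
  parentsFirst⇒ltree {π} ord root first = record
    { root  = root
    ; edges = λ u v → mk⇔ (λ u~v → ↑⇒LParent (Equivalence.to Adj⇔↑ u~v))
                           (λ par → Equivalence.from Adj⇔↑ (LParent⇒↑ par))
    }
    where
    !π = order-unique ord

    ↑⇒LParent : u ↑ v ⊎ v ↑ u → IsLParent G π u v ⊎ IsLParent G π v u
    ↑⇒LParent = Sum.map (parentsFirst⇒LParent !π first) (parentsFirst⇒LParent !π first)

    -- The tree parent of `v` is also an ℒ-parent, and ℒ-parents are unique.
    parent⁻ : IsLParent G π v p → v ↑ p
    parent⁻ par@(_ , p≺v , _)
      with q , v↑q ← parent (λ {refl → head-minimal ord root p≺v})
      with refl ← LParent-unique {G = G} !π par (parentsFirst⇒LParent !π first v↑q) = v↑q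

    LParent⇒↑ : IsLParent G π u v ⊎ IsLParent G π v u → u ↑ v ⊎ v ↑ u
    LParent⇒↑ = Sum.map parent⁻ parent⁻

  -- Climb from `w` until the parent is visited, at the latest below `s`. If `us` is closed under
  -- ancestors, `c` is the topmost unvisited ancestor of `w`.
  top-unvisited : ∀ {us : List (Fin n)} → s ∈ us → w ∉ us → ∃[ c ] ∃[ a ] (w ↟ c × c ↑ a × c ∉ us × a ∈ us)
  top-unvisited {us = us} s∈ w∉ = go w∉ (to-root _)
    where
    go : w ∉ us → w ↟ s → ∃[ c ] ∃[ a ] (w ↟ c × c ↑ a × c ∉ us × a ∈ us)
    go w∉ ε = contradiction s∈ w∉
    go w∉ (_◅_ {j = p} w↑p p↟s) with DecMembership._∈?_ _≟_ p us
    ... | yes p∈ = _ , p , ε , w↑p , w∉ , p∈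
    ... | no  p∉ with c , a , p↟c , rest ← go p∉ p↟s = c , a , w↑p ◅ p↟c , rest

  proper-ancestor : v ↑ u → v ↟ x → x ≢ v → u ↟ x
  proper-ancestor v↑u ε           x≢v = contradiction refl x≢v
  proper-ancestor v↑u (v↑q ◅ q↟x) x≢v with refl ← ↑-unique v↑u v↑q = q↟x

  proper-ancestor-≺ : Unique π → ParentsFirst π → v ↑ u → u ↟ x → x ≺[ π ] v
  proper-ancestor-≺ !π first v↑u u↟x with ↟⇒≺ !π first u↟x
  ... | inj₁ refl = first v↑u
  ... | inj₂ x≺u  = ≺-trans !π x≺u (first v↑u)

  left-neighbour⇒↟parent : Unique π → ParentsFirst π → v ↑ u → Adj G x v → x ≺[ π ] v → u ↟ x
  left-neighbour⇒↟parent !π first v↑u x~v x≺v =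
    proper-ancestor v↑u (left-neighbour⇒ancestor !π first x~v x≺v) λ {refl → Graph.~-irrefl G x~v}

  -- Refinement along a reversed BFS order

  module _ {bfs : List (Fin n)} (ord : IsVertexOrder bfs) (root : head bfs ≡ just s)
    (first : ParentsFirst bfs) where

    private
      β = reverse bfs
      -- Because `β` is reversed, `N v` holds the neighbours of `v` that come later in `bfs`, that
      -- is, those below `v` in the tree.
      N = leftNeighbours G β
      !bfs = order-unique ord

    -- Refining with `N x` favours `c`, so some `y` processed before `x`, hence later in `bfs`,
    -- already favoured `v`. Siblings have the same proper ancestors, so `y` precedes `c` in `bfs`
    -- too and `c` can be missing from `N y` only by not being adjacent to `y`.
    refineAlong-⊴ : refineAlong G β ⊢ v ⊴ c → v ↑ u → c ↑ u → u ↟ x → Adj G x c → ¬ Adj G x v →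
      ∃[ y ] (u ↟ y × x ≺[ bfs ] y × Adj G y v × ¬ Adj G y c)
    refineAlong-⊴ v⊴c v↑u c↑u u↟x x~c x≁v
      with pre , post , eq ← ∈-∃++ (Any.reverse⁺ (∈-order ord _))
      with y , y∈pre , v∈N , c∉N ← refineBy-⊴ N pre (subst (λ us → refineBy N _ us ⊢ _ ⊴ _) eq v⊴c)
             (∈-leftNeighbours⁺ G β x~c (reverse⁺ (proper-ancestor-≺ !bfs first c↑u u↟x)))
             (λ v∈ → x≁v (proj₁ (∈-leftNeighbours⁻ G β v∈)))
      with y~v , v≺y ← ∈-leftNeighbours⁻ G β v∈N =
      y , u↟y , ≺-reverse⁻ (subst (y ≺[_] _) (sym eq) (∈-prefix⇒≺ y∈pre)) , y~v ,
      λ y~c → c∉N (∈-leftNeighbours⁺ G β y~c (reverse⁺ (proper-ancestor-≺ !bfs first c↑u u↟y)))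
      where
      u↟y = left-neighbour⇒↟parent !bfs first v↑u y~v (≺-reverse⁻ v≺y)

    -- No `N v` contains `s`, the first vertex of `bfs`, while any other `w` lies in the set of its
    -- parent. A class shared by `s` and `w` would therefore need an earlier refinement favouring
    -- `s`.
    root-class : ⁅ s ⁆ ∈ refineAlong G β
    root-class with Q , Q∈ , s∈Q ← find (refineBy-covers N {𝒬 = [ ⊤ ]} β (here ∈⊤)) =
      subst (_∈ refineAlong G β) (⊆-antisym
        (λ w∈Q → subst (_∈ₛ ⁅ s ⁆) (sym (only-root Q∈ s∈Q w∈Q)) (x∈⁅x⁆ s))
        (λ w∈ → subst (_∈ₛ Q) (sym (x∈⁅y⁆⇒x≡y s w∈)) s∈Q)) Q∈
      where
      s∉N : ∀ v → s ∉ₛ N v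
      s∉N v s∈ = head-minimal ord root (≺-reverse⁻ (proj₂ (∈-leftNeighbours⁻ G β s∈)))

      only-root : ∀ {Q} → Q ∈ refineAlong G β → s ∈ₛ Q → w ∈ₛ Q → w ≡ s
      only-root {w = w} Q∈ s∈Q w∈Q = decidable-stable (w ≟ s) λ w≢s →
        let p , w↑p = parent w≢s
            pre , post , eq = ∈-∃++ (Any.reverse⁺ (∈-order ord p))
            y , _ , s∈N , _ = refineBy-⊴ N pre
              (subst (λ us → refineBy N _ us ⊢ _ ⊴ _) eq (class⇒⊴ Q∈ s∈Q w∈Q))
              (∈-leftNeighbours⁺ G β (Graph.~-sym G (↑⇒Adj w↑p)) (reverse⁺ (first w↑p))) (s∉N p)
        in s∉N y s∈N

    last-tieBreak : ∀ {ρ} → s ∈ ρ → last (tieBreak G s ρ β) ≡ just s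
    last-tieBreak s∈ρ = trans (last-reverse _)
      (head-listClasses-moveLeftmost (Any.reverse⁺ s∈ρ) root-class)

    -- The class list is reversed in the tie-breaking order, so the vertex further right has the
    -- class at or before the other's; moving the class of `s` does not affect `v`.
    tieBreak-≺ : ∀ ρ → v ≢ s → c ≺[ tieBreak G s ρ β ] v → refineAlong G β ⊢ v ⊴ c
    tieBreak-≺ ρ v≢s c≺v = moveLeftmost-⊴⁻ _ (refineAlong G β) (λ v∈ → v≢s (x∈⁅y⁆⇒x≡y s v∈))
      (listClasses-≺⁻ (reverse ρ) _ (≺-reverse⁻ c≺v))

  -- Comparing labels of unvisited vertices

  prefix-closed : Unique (xs ++ ys) → ParentsFirst (xs ++ ys) → x ↟ y → x ∈ xs → y ∈ xs
  prefix-closed {xs = xs} !σ first x↟y x∈xs with ↟⇒≺ !σ first x↟y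
  ... | inj₁ refl = x∈xs
  ... | inj₂ y≺x  = ≺⇒∈ˡ (≺-prefix xs !σ y≺x x∈xs)

  -- Visited vertices are closed under ancestors, so `x` is not at or below the unvisited `c`. Being
  -- comparable with `w`, it lies strictly above `c`.
  visited-neighbour⇒ancestor : Unique (xs ++ ys) → ParentsFirst (xs ++ ys) →
    w ↟ c → c ↑ u → c ∉ xs → x ∈ xs → Adj G x w → u ↟ x
  visited-neighbour⇒ancestor {xs = xs} {c = c} {u = u} {x = x} !σ first w↟c c↑u c∉xs x∈xs x~w =
    below (comparable x~w)
    where
    x↟̸c : ¬ x ↟ c
    x↟̸c x↟c = c∉xs (prefix-closed !σ first x↟c x∈xs)

    below : x ↟ _ ⊎ _ ↟ x → u ↟ x
    below (inj₁ x↟w) = contradiction (x↟w ◅◅ w↟c) x↟̸c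
    below (inj₂ w↟x) with ↟-chain w↟c w↟x
    ... | inj₁ c↟x = proper-ancestor c↑u c↟x λ {refl → c∉xs x∈xs}
    ... | inj₂ x↟c = contradiction x↟c x↟̸c

  module _ {xs ys} (!σ : Unique (xs ++ ys)) (firstσ : ParentsFirst (xs ++ ys)) where

    -- Carries comparisons made in the BFS order or in a LexDFS order over to the visited prefix,
    -- which contains all ancestors of `u`.
    transfer-≺ : Unique π → ParentsFirst π → u ∈ xs → u ↟ x → u ↟ y → x ≺[ π ] y → x ≺[ xs ] y
    transfer-≺ !π first u∈xs u↟x u↟y x≺y = ≺-prefix xs !σ
      (ancestors-≺ !π first !σ firstσ u↟x u↟y x≺y) (prefix-closed !σ firstσ u↟y u∈xs)

    -- The witness is always `u`. Visited neighbours of `w` are ancestors of `a`, hence not after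
    -- `a`, which precedes `u`; so they come before `u`, and `u` is not among them.
    outweighed-later-parent : Adj G u v → w ↟ c → c ↑ a → c ∉ xs → a ≺[ xs ] u → Outweighed G xs w v
    outweighed-later-parent {u = u} u~v w↟c c↑a c∉xs a≺u {x} x∈xs x~w x≁v = u , x≺u , u~v , λ u~w →
      after (visited-neighbour⇒ancestor !σ firstσ w↟c c↑a c∉xs (≺⇒∈ʳ a≺u) u~w)
      where
      !xs = prefix-unique xs !σ
      a∈xs = ≺⇒∈ˡ a≺u

      after : ¬ _ ↟ u
      after a↟u with ↟⇒≺ !σ firstσ a↟u
      ... | inj₁ refl = ≺-irrefl !xs a≺u
      ... | inj₂ u≺a  = ≺-asym !xs a≺u (≺-prefix xs !σ u≺a a∈xs)

      x≺u : x ≺[ xs ] u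
      x≺u with ↟⇒≺ !σ firstσ (visited-neighbour⇒ancestor !σ firstσ w↟c c↑a c∉xs x∈xs x~w)
      ... | inj₁ refl = a≺u
      ... | inj₂ x≺a  = ≺-trans !xs (≺-prefix xs !σ x≺a a∈xs) a≺u

    outweighed-sibling : ∀ {bfs} → IsVertexOrder bfs → head bfs ≡ just s → ParentsFirst bfs →
      refineAlong G (reverse bfs) ⊢ v ⊴ c → v ↑ u → c ↑ u → u ∈ xs → c ∉ xs → Outweighed G xs c v
    outweighed-sibling ord root first v⊴c v↑u c↑u u∈xs c∉xs x∈xs x~c x≁v =
      let u↟x = visited-neighbour⇒ancestor !σ firstσ ε c↑u c∉xs x∈xs x~c
          y , u↟y , x≺y , y~v , y≁c = refineAlong-⊴ ord root first v⊴c v↑u c↑u u↟x x~c x≁v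
      in y , transfer-≺ (order-unique ord) first u∈xs u↟x u↟y x≺y , y~v , y≁c

    -- When `π` visits `c`, its descendant `w` is still unvisited, so LexDFS bounds the label of `w`
    -- by that of `c`. In both orders the neighbours concerned are ancestors of `u`, so the witness
    -- transfers.
    outweighed-subtree : IsLexDFSOrder G π → IsLTreeOfOrder G π T s →
      w ↟ c → w ∉ xs → s ∈ xs → c ↑ u → u ∈ xs → c ∉ xs → Outweighed G xs w c
    outweighed-subtree {π = π} {w} {c} {u} lex ltree w↟c w∉xs s∈xs c↑u u∈xs c∉xs x∈xs x~w x≁c
      with ord , maximal ← lexDFS-root G lex (IsLTreeOfOrder.root ltree)
      with ls , rs , refl ← ∈-∃++ (∈-order ord c) =
      let u↟x = visited-neighbour⇒ancestor !σ firstσ w↟c c↑u c∉xs x∈xs x~w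
          x∈ls = ≺⇒∈-prefix ls !π (proper-ancestor-≺ !π first c↑u u↟x)
          y , x≺y , y~c , y≁w = label≤⇒outweighed G ls w≢s c≢s
            (maximal ls c rs refl w λ w∈ls → c∉ls (prefix-closed !π first w↟c w∈ls)) x∈ls x~w x≁c
          u↟y = visited-neighbour⇒ancestor !π first ε c↑u c∉ls (≺⇒∈ʳ x≺y) y~c
      in y , transfer-≺ !π first u∈xs u↟x u↟y (++⁺ʳ-≺ x≺y) , y~c , y≁w
      where
      !π = order-unique ord
      c∉ls = prefix-∉ ls !π

      first : ParentsFirst π
      first v↑p = proj₁ (proj₂ (ltree-parent ord ltree v↑p))

      w≢s : w ≢ s
      w≢s refl = w∉xs s∈xs

      c≢s : c ≢ s
      c≢s refl = root-top c↑u

-- The order output by the procedure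

module _ {n} {G T : Graph n} {s : Fin n} {ρ σ : List (Fin n)} (tree : TrémauxTree G T s)
  (s∈ρ : s ∈ ρ) (output : IsOrderingOutput G T s ρ σ) where
  open TrémauxTree tree

  private
    bfs = proj₁ output
    bfsOrder = proj₁ (proj₂ output)
    bfs-root = proj₁ (proj₂ (proj₂ output))
    dfs⁺ = proj₂ (proj₂ (proj₂ output))

    bfsFirst : ParentsFirst tree bfs
    bfsFirst = search-parentsFirst tree (proj₁ bfsOrder) bfs-root λ x xs v ys eq →
      let _ , as , u , _ , visited , u~v , _ = proj₂ bfsOrder x xs v ys eq
      in u , subst (u ∈_) (sym visited) (∈-++⁺ʳ as (here refl)) , u~v

  output-order : IsVertexOrder σ
  output-order = proj₁ (proj₂ dfs⁺)

  output-root : head σ ≡ just s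
  output-root = trans (proj₁ dfs⁺) (last-tieBreak tree (proj₁ bfsOrder) bfs-root bfsFirst s∈ρ)

  output-parentsFirst : ParentsFirst tree σ
  output-parentsFirst = search-parentsFirst tree output-order output-root λ x xs v ys eq →
    let (_ , as , u , _ , visited , u~v , _) , _ = proj₂ (proj₂ dfs⁺) x xs v ys eq
    in u , subst (u ∈_) (sym visited) (∈-++⁺ʳ as (here refl)) , u~v

  ltree⇒output-lexDFS : ∀ {π} → IsLexDFSOrder G π → IsLTreeOfOrder G π T s → IsLexDFSOrder G σ
  ltree⇒output-lexDFS {π} lex ltree = s , output-order , λ xs v ys eq → maximal xs v ys eq output-root
    where
    -- The head equation is an argument so that matching on it turns the first visited vertex into
    -- `s`.
    maximal : ∀ xs v ys → σ ≡ xs ++ v ∷ ys → head σ ≡ just s →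
      ∀ w → w ∉ xs → label G s xs w ≤ₗₑₓ label G s xs v
    maximal [] v ys refl refl w _ = root-label-maximal G s w
    maximal (x ∷ xs) v ys refl refl w w∉
      with (v∉ , as , u , bs , eq , u~v , exhausted) , rightmost ← proj₂ (proj₂ dfs⁺) x xs v ys refl
      with c , a , w↟c , c↑a , c∉ , a∈ ← top-unvisited tree {us = x ∷ xs} (here refl) w∉ =
      compare (∈-++⁻ as (subst (a ∈_) eq a∈))
      where
      !σ = order-unique output-order
      us = x ∷ xs

      u∈ : u ∈ us
      u∈ rewrite eq = ∈-++⁺ʳ as (here refl)

      v↑u : v ↑ u
      v↑u with Equivalence.to Adj⇔↑ u~v
      ... | inj₂ v↑u = v↑u
      ... | inj₁ u↑v = contradiction (output-parentsFirst u↑v) (≺-asym !σ (∈-prefix⇒≺ u∈))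

      unvisited-≢s : ∀ {y} → y ∉ us → y ≢ s
      unvisited-≢s y∉ refl = y∉ (here refl)

      outweighed⇒≤ : ∀ {y z} → y ∉ us → z ∉ us → Outweighed G us y z → label G s us y ≤ₗₑₓ label G s us z
      outweighed⇒≤ y∉ z∉ = outweighed⇒label≤ G us (prefix-unique us !σ) (unvisited-≢s y∉) (unvisited-≢s z∉)

      a~c : Adj T a c
      a~c = Equivalence.from Adj⇔↑ (inj₂ c↑a)

      compare : a ∈ as ⊎ a ∈ u ∷ bs → label G s us w ≤ₗₑₓ label G s us v
      compare (inj₁ a∈as) = outweighed⇒≤ w∉ v∉ (outweighed-later-parent tree !σ output-parentsFirst
        (Graph.~-sym G (↑⇒Adj v↑u)) w↟c c↑a c∉ (subst (a ≺[_] u) (sym eq) (∈-prefix⇒≺ a∈as)))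
      -- A visited vertex after `u` has no unvisited tree neighbour, but `c` would be one.
      compare (inj₂ (there a∈bs)) = contradiction (All.lookup exhausted a∈bs c a~c) c∉
      -- Now `c` is a sibling of `v` or `v` itself, and its label lies between those of `w` and `v`.
      compare (inj₂ (here refl)) = ≤ₗₑₓ-trans
        (outweighed⇒≤ w∉ c∉ (outweighed-subtree tree !σ output-parentsFirst lex ltree w↟c w∉ (here refl) c↑a u∈ c∉))
        c≤v
        where
        c≤v : label G s us c ≤ₗₑₓ label G s us v
        -- `c` was also eligible at this step of the DFS, so it is `v` or lost the tie against `v`.
        c≤v with rightmost c (c∉ , as , u , bs , eq , a~c , exhausted)
        ... | inj₁ refl = ≤ₗₑₓ-refl
        ... | inj₂ c≺v = outweighed⇒≤ c∉ v∉ (outweighed-sibling tree !σ output-parentsFirst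
          (proj₁ bfsOrder) bfs-root bfsFirst
          (tieBreak-≺ tree (proj₁ bfsOrder) bfs-root bfsFirst ρ (unvisited-≢s v∉) c≺v) v↑u c↑a u∈ c∉)

theorem7 : ∀ {n : ℕ} (G T : Graph n) (s : Fin n) (ρ σ : List (Fin n)) →
    Connected G →
    IsSpanningTree G T →
    IsLTreeOf IsDFSOrder G T s →
    IsVertexOrder ρ →
    last ρ ≡ just s →
    IsOrderingOutput G T s ρ σ →
    (IsLTreeOf IsLexDFSOrder G T s ⇔ IsLexDFSOrder G σ)
theorem7 G T s ρ σ _ _ (δ , dfs , ltree) ρ-order _ output = mk⇔
  (λ (π , lex , ltreeπ) → ltree⇒output-lexDFS tree s∈ρ output lex ltreeπ)
  (λ lex → σ , lex , parentsFirst⇒ltree tree (output-order tree s∈ρ output)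
    (output-root tree s∈ρ output) (output-parentsFirst tree s∈ρ output))
  where
  tree = dfsTrémauxTree dfs ltree
  s∈ρ = ∈-order ρ-order s
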